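{- There exist (uncolored, hence in particular colored) multiset Eulerian polynomials that are not $s$-Eulerian: there exist $n\ge1$ and $\mathbf{m}\in\mathbb{Z}_{>0}^n$ such that, with $\mathbf{1}=(1,\dots,1)\in\mathbb{Z}^n$, the polynomial $A_{\mathbf{m}}^{\mathbf{1}}$ is not equal to $E_N^s$ for any integer $N\ge1$ and any sequence of positive integers $s=(s_1,s_2,\dots)$.
   Context: For $\mathbf{m}=(m_1,\dots,m_n)$ a vector of positive integers with $m=m_1+\cdots+m_n$, the multiset Eulerian polynomial is $A_{\mathbf{m}}^{\mathbf{1}}=\sum_{\pi}x^{\mathrm{des}(\pi)}$, the sum over all words $\pi=\pi_1\cdots\pi_m$ in which each $k\in\{1,\dots,n\}$ appears exactly $m_k$ times, where $\mathrm{des}(\pi)=|\{j\in\{1,\dots,m-1\}:\pi_j>\pi_{j+1}\}|$. (This is the case of all color bounds equal to $1$ of the colored multiset Eulerian polynomials $A_{\mathbf{m}}^{\mathbf{r}}$.) For a sequence of positive integers $s=(s_1,s_2,\dots)$ and $N\ge1$, the $s$-Eulerian polynomial is $E_N^s=\sum_{e}x^{\mathrm{asc}(e)}$ over all $e\in\mathbb{Z}^N$ with $0\le e_i\le s_i-1$ for all $i$, where $\mathrm{asc}(e)=|\{i\in\{0,\dots,N-1\}:e_i/s_i<e_{i+1}/s_{i+1}\}|$ with $e_0:=0$, $s_0:=1$. (Equivalently, it is the Ehrhart $h^*$-polynomial of the simplex $\{x\in\mathbb{R}^N:0\le x_1/s_1\le\cdots\le x_N/s_N\le1\}$.) A polynomial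 is $s$-Eulerian if it equals $E_N^s$ for some $N$ and $s$. -}

module Defs where

open import Data.Fin.Base using (Fin; toℕ)
open import Data.Fin.Properties using (all?) renaming (_≟_ to _≟ᶠ_; _<?_ to _<?ᶠ_)
open import Data.Integer.Base using (+_)
open import Data.List.Base
  using (List; []; _∷_; _++_; [_]; allFin; cartesianProductWith; drop; filter; foldr; length; map; replicate; upTo; zip)
open import Data.Nat.Base using (ℕ; zero; suc; _+_; NonZero)
import Data.Nat.Properties as ℕ
open import Data.Product.Base using (_×_; _,_)
open import Data.Rational.Unnormalised.Base using (ℚᵘ; _/_)
import Data.Rational.Unnormalised.Properties as ℚᵘ
open import Data.Vec.Base as Vec using (Vec; []; _∷_; lookup; tabulate; toList)
open import Function.Base using (_∘_)
open import Relation.Binary.PropositionalEquality.Core using (_≡_)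
open import Relation.Unary using (Decidable)

-- Coefficient lists, constant term first.  Trailing zeros are allowed, so
-- equality of polynomials is _≈_ rather than _≡_.
Polynomial : Set
Polynomial = List ℕ

coeff : Polynomial → ℕ → ℕ
coeff []      _       = 0
coeff (a ∷ _) zero    = a
coeff (_ ∷ p) (suc k) = coeff p k

infix 4 _≈_
_≈_ : Polynomial → Polynomial → Set
p ≈ q = ∀ k → coeff p k ≡ coeff q k

infixl 6 _⊕_
_⊕_ : Polynomial → Polynomial → Polynomial
[]      ⊕ q       = q
(a ∷ p) ⊕ []      = a ∷ p
(a ∷ p) ⊕ (b ∷ q) = (a + b) ∷ (p ⊕ q)

x^_ : ℕ → Polynomial
x^ k = replicate k 0 ++ [ 1 ]

-- ∑x^ f as = ∑_{a ∈ as} x^{f(a)}, counted with multiplicity in the list as.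
∑x^ : {A : Set} → (A → ℕ) → List A → Polynomial
∑x^ f as = foldr _⊕_ [] (map (x^_ ∘ f) as)

-- All vectors whose i-th entry is taken from the i-th list.
tuples : {A : Set} {n : ℕ} → Vec (List A) n → List (Vec A n)
tuples []         = [ [] ]
tuples (as ∷ ass) = cartesianProductWith _∷_ as (tuples ass)

adjacentPairs : {A : Set} → List A → List (A × A)
adjacentPairs as = zip as (drop 1 as)

module _ {n : ℕ} (m : Vec ℕ n) where

  HasContent : Vec (Fin n) (Vec.sum m) → Set
  HasContent π = ∀ k → Vec.count (_≟ᶠ k) π ≡ lookup m k

  hasContent? : Decidable HasContent
  hasContent? π = all? λ k → Vec.count (_≟ᶠ k) π ℕ.≟ lookup m k

  multisetPermutations : List (Vec (Fin n) (Vec.sum m))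
  multisetPermutations = filter hasContent? (tuples (Vec.replicate (Vec.sum m) (allFin n)))

des : {n l : ℕ} → Vec (Fin n) l → ℕ
des π = length (filter (λ (a , b) → b <?ᶠ a) (adjacentPairs (toList π)))

multisetEulerian : {n : ℕ} → Vec ℕ n → Polynomial
multisetEulerian m = ∑x^ des (multisetPermutations m)

-- Sequences (s₁, s₂, …) are indexed from zero: s i stands for s_{i+1}, and
-- likewise lookup e i stands for e_{i+1}.
module _ (s : ℕ → ℕ) where

  inversionSequences : (N : ℕ) → List (Vec ℕ N)
  inversionSequences N = tuples (tabulate λ i → upTo (s (toℕ i)))

  module _ .{{_ : ∀ {i} → NonZero (s i)}} where

    -- e₀/s₀, e₁/s₁, …, e_N/s_N with e₀ = 0 and s₀ = 1.
    ratios : {N : ℕ} → Vec ℕ N → Vec ℚᵘ (suc N)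
    ratios e = (+ 0 / 1) ∷ tabulate λ i → + lookup e i / s (toℕ i)

    asc : {N : ℕ} → Vec ℕ N → ℕ
    asc e = length (filter (λ (p , q) → p ℚᵘ.<? q) (adjacentPairs (toList (ratios e))))

    sEulerian : ℕ → Polynomial
    sEulerian N = ∑x^ asc (inversionSequences N)

{-# OPTIONS --safe #-}
-- Take m = (3, 2), for which A(x) = 1 + 6x + 3x², so A(1) = 10 and A(2) = 25.
-- If A = E_N^s, then s₁⋯s_N = E(1) = 10.  An entry sᵢ = 1 forces eᵢ = 0: it
-- creates no ascent and resets the ratio to 0.  So, up to ones, s is (10),
-- (2,5), (5,2), or one of the latter two with a reset in between.  This leaves
-- only 1 + 9x, 1 + 7x + 2x² and (1 + x)(1 + 4x), whose values at 2 are 19, 23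
-- and 27.
module Submission where

open import Defs
open import Data.Bool.Base using (true; false; if_then_else_)
open import Data.Bool.Properties using (if-eta)
open import Data.Fin.Base using (zero; suc)
open import Data.Integer.Base using () renaming (+_ to pos)
open import Data.List.Base using (List; []; _∷_; _++_; cartesianProductWith; filter; length; map; upTo)
open import Data.List.Membership.Propositional using (_∈_)
open import Data.List.Properties using (length-upTo; map-++; map-cong; map-∘)
open import Data.List.Relation.Unary.Any using (here; there)
open import Data.Nat.Base using (ℕ; zero; suc; _+_; _*_; _^_; _≥_; z≤n; s≤s; NonZero)
open import Data.Nat.Divisibility using (_∣_; _∣?_; m∣m*n; ∣⇒≤)
open import Data.Nat.ListAction using (sum)
open import Data.Nat.ListAction.Properties using (sum-++)
open import Data.Nat.Primality using (Prime; prime?; prime⇒irreducible)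
open import Data.Nat.Properties
  using (_≟_; allUpTo?; *-cancelˡ-≡; *-distribˡ-+; *-identityˡ; *-identityʳ; *-zeroʳ; +-identityʳ; m*n≡1⇒m≡1; m*n≡1⇒n≡1)
open import Data.Nat.Tactic.RingSolver using (solve-∀)
open import Data.Product.Base using (Σ-syntax; _×_; _,_)
open import Data.Rational.Unnormalised.Base using (ℚᵘ; 0ℚᵘ; _/_) renaming (_≤_ to _≤ᵘ_)
import Data.Rational.Unnormalised.Properties as ℚᵘ
open import Data.Sum.Base using (_⊎_; inj₁; inj₂)
open import Data.Vec.Base as Vec using (Vec; []; _∷_; lookup; toList)
open import Function.Base using (_∘_; const)
open import Relation.Binary.PropositionalEquality
  using (_≡_; refl; sym; trans; cong; cong₂; subst; module ≡-Reasoning)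
open import Relation.Nullary.Decidable using (does; dec-false; from-yes; _→-dec_; _⊎-dec_)
open import Relation.Nullary.Negation.Core using (¬_; contradiction)

∑ : {A : Set} → (A → ℕ) → List A → ℕ
∑ f as = sum (map f as)

∑-cong : {A : Set} {f g : A → ℕ} → (∀ a → f a ≡ g a) → ∀ as → ∑ f as ≡ ∑ g as
∑-cong f≗g as = cong sum (map-cong f≗g as)

∑-++ : {A : Set} (f : A → ℕ) (as bs : List A) → ∑ f (as ++ bs) ≡ ∑ f as + ∑ f bs
∑-++ f as bs = trans (cong sum (map-++ f as bs)) (sum-++ (map f as) (map f bs))

∑-*ˡ : {A : Set} (c : ℕ) (f : A → ℕ) (as : List A) → ∑ (λ a → c * f a) as ≡ c * ∑ f as
∑-*ˡ c f []       = sym (*-zeroʳ c)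
∑-*ˡ c f (a ∷ as) = trans (cong (_ +_) (∑-*ˡ c f as)) (sym (*-distribˡ-+ c (f a) (∑ f as)))

∑-const : {A : Set} (c : ℕ) (as : List A) → ∑ (const c) as ≡ length as * c
∑-const c []       = refl
∑-const c (a ∷ as) = cong (c +_) (∑-const c as)

∑-cartesianProductWith :
  {A B C : Set} (h : C → ℕ) (f : A → B → C) (as : List A) (bs : List B) →
  ∑ h (cartesianProductWith f as bs) ≡ ∑ (λ a → ∑ (h ∘ f a) bs) as
∑-cartesianProductWith h f []       bs = refl
∑-cartesianProductWith h f (a ∷ as) bs = trans
  (∑-++ h (map (f a) bs) _)
  (cong₂ _+_ (cong sum (sym (map-∘ bs))) (∑-cartesianProductWith h f as bs))

eval : ℕ → Polynomial → ℕ
eval x []      = 0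
eval x (a ∷ p) = a + x * eval x p

eval-≈[] : ∀ x p → p ≈ [] → eval x p ≡ 0
eval-≈[] x []      p≈[] = refl
eval-≈[] x (a ∷ p) p≈[] =
  trans (cong₂ _+_ (p≈[] 0) (cong (x *_) (eval-≈[] x p (p≈[] ∘ suc)))) (*-zeroʳ x)

-- Lists related by `≈` may differ in length, but the surplus entries of the longer one are zeros,
-- and those contribute nothing to Horner's rule.
eval-≈ : ∀ x p q → p ≈ q → eval x p ≡ eval x q
eval-≈ x []      q       p≈q = sym (eval-≈[] x q (sym ∘ p≈q))
eval-≈ x (a ∷ p) []      p≈q = eval-≈[] x (a ∷ p) p≈q
eval-≈ x (a ∷ p) (b ∷ q) p≈q = cong₂ (λ c v → c + x * v) (p≈q 0) (eval-≈ x p q (p≈q ∘ suc))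

eval-⊕ : ∀ x p q → eval x (p ⊕ q) ≡ eval x p + eval x q
eval-⊕ x []      q       = refl
eval-⊕ x (a ∷ p) []      = sym (+-identityʳ _)
eval-⊕ x (a ∷ p) (b ∷ q) =
  trans (cong (λ v → a + b + x * v) (eval-⊕ x p q)) (interchange a b x (eval x p) (eval x q))
  where
  interchange : ∀ a b x u v → a + b + x * (u + v) ≡ a + x * u + (b + x * v)
  interchange = solve-∀

eval-x^ : ∀ x k → eval x (x^ k) ≡ x ^ k
eval-x^ x zero    = cong suc (*-zeroʳ x)
eval-x^ x (suc k) = cong (x *_) (eval-x^ x k)

eval-∑x^ : ∀ x {A : Set} (f : A → ℕ) (as : List A) → eval x (∑x^ f as) ≡ ∑ (λ a → x ^ f a) as
eval-∑x^ x f []       = refl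
eval-∑x^ x f (a ∷ as) =
  trans (eval-⊕ x (x^ f a) (∑x^ f as)) (cong₂ _+_ (eval-x^ x (f a)) (eval-∑x^ x f as))

0≤a/d : ∀ a d .{{_ : NonZero d}} → 0ℚᵘ ≤ᵘ pos a / d
0≤a/d zero    (suc d) = ℚᵘ.nonNegative⁻¹ (pos 0 / suc d)
0≤a/d (suc a) (suc d) = ℚᵘ.nonNegative⁻¹ (pos (suc a) / suc d)

prod : (ℕ → ℕ) → ℕ → ℕ
prod s zero    = 1
prod s (suc N) = s 0 * prod (s ∘ suc) N

prod-tail : ∀ s N {d} k .{{_ : NonZero d}} → s 0 ≡ d → prod s (suc N) ≡ d * k → prod (s ∘ suc) N ≡ k
prod-tail s N k refl = *-cancelˡ-≡ _ k (s 0)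

-- The starting ratio is free so that recursion on the sequence is possible: after the first entry
-- `a`, the rest starts from `a / s 0`. At `r = 0ℚᵘ` this is `asc s e` by computation.
ascFrom : ℚᵘ → (s : ℕ → ℕ) .{{_ : ∀ {i} → NonZero (s i)}} {N : ℕ} → Vec ℕ N → ℕ
ascFrom r s e =
  length (filter (λ (p , q) → p ℚᵘ.<? q) (adjacentPairs (toList (r ∷ Vec.tail (ratios s e)))))

module _ (x : ℕ) where

  -- E_N^s at the point x, with the initial ratio e₀/s₀ = 0 replaced by r.
  E : ℚᵘ → (s : ℕ → ℕ) .{{_ : ∀ {i} → NonZero (s i)}} → ℕ → ℕ
  E r s N = ∑ (λ e → x ^ ascFrom r s e) (inversionSequences s N)

  weight : ℚᵘ → ℚᵘ → ℕ
  weight r q = if does (r ℚᵘ.<? q) then x else 1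

  weight-0 : ∀ {r} → 0ℚᵘ ≤ᵘ r → weight r 0ℚᵘ ≡ 1
  weight-0 {r} 0≤r =
    cong (if_then x else 1) (dec-false (r ℚᵘ.<? 0ℚᵘ) λ r<0 → ℚᵘ.<⇒≱ r<0 0≤r)

  ascFrom-∷ : ∀ r (s : ℕ → ℕ) .{{_ : ∀ {i} → NonZero (s i)}} {N} a (e : Vec ℕ N) →
    x ^ ascFrom r s (a ∷ e) ≡ weight r (pos a / s 0) * x ^ ascFrom (pos a / s 0) (s ∘ suc) e
  ascFrom-∷ r s a e with does (r ℚᵘ.<? (pos a / s 0))
  ... | true  = refl
  ... | false = sym (*-identityˡ _)

  -- Group by the first entry `a`: whether it makes an ascent depends only on `r`, and later entries
  -- see it only through its ratio.
  E-suc : ∀ r (s : ℕ → ℕ) .{{_ : ∀ {i} → NonZero (s i)}} N →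
    E r s (suc N) ≡ ∑ (λ a → weight r (pos a / s 0) * E (pos a / s 0) (s ∘ suc) N) (upTo (s 0))
  E-suc r s N = trans
    (∑-cartesianProductWith _ _∷_ (upTo (s 0)) es)
    (∑-cong (λ a → trans (∑-cong (ascFrom-∷ r s a) es) (∑-*ˡ (weight r (pos a / s 0)) (tailTerm a) es))
      (upTo (s 0)))
    where
    es = inversionSequences (s ∘ suc) N
    tailTerm : ℕ → Vec ℕ N → ℕ
    tailTerm a e = x ^ ascFrom (pos a / s 0) (s ∘ suc) e

  -- Naming the value of `s 0` makes it possible to put a numeral for `d`, and then `upTo d` and the
  -- ratios compute.
  E-suc-≡ : ∀ r (s : ℕ → ℕ) .{{_ : ∀ {i} → NonZero (s i)}} N {d} .{{_ : NonZero d}} → s 0 ≡ d →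
    E r s (suc N) ≡ ∑ (λ a → weight r (pos a / d) * E (pos a / d) (s ∘ suc) N) (upTo d)
  E-suc-≡ r s N refl = E-suc r s N

  E-suc-1 : ∀ {r} → 0ℚᵘ ≤ᵘ r → ∀ s .{{_ : ∀ {i} → NonZero (s i)}} N → s 0 ≡ 1 →
    E r s (suc N) ≡ E 0ℚᵘ (s ∘ suc) N
  E-suc-1 {r} 0≤r s N s₀≡1 = begin
    E r s (suc N)                                 ≡⟨ E-suc-≡ r s N s₀≡1 ⟩
    -- `upTo 1` contains only 0, whose ratio is `0ℚᵘ` whatever `r` was.
    weight r 0ℚᵘ * E 0ℚᵘ (s ∘ suc) N + 0          ≡⟨ +-identityʳ _ ⟩
    weight r 0ℚᵘ * E 0ℚᵘ (s ∘ suc) N              ≡⟨ cong (_* E 0ℚᵘ (s ∘ suc) N) (weight-0 0≤r) ⟩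
    1 * E 0ℚᵘ (s ∘ suc) N                         ≡⟨ *-identityˡ _ ⟩
    E 0ℚᵘ (s ∘ suc) N                             ∎
    where open ≡-Reasoning

  -- Every entry of `s` is 1, so only the zero sequence contributes, and it has no ascent from a
  -- nonnegative start.
  E-prod≡1 : ∀ s .{{_ : ∀ {i} → NonZero (s i)}} N → prod s N ≡ 1 → ∀ {r} → 0ℚᵘ ≤ᵘ r → E r s N ≡ 1
  E-prod≡1 s zero    _      0≤r = refl
  E-prod≡1 s (suc N) prod≡1 0≤r = trans
    (E-suc-1 0≤r s N (m*n≡1⇒m≡1 (s 0) _ prod≡1))
    (E-prod≡1 (s ∘ suc) N (m*n≡1⇒n≡1 (s 0) _ prod≡1) (0≤a/d 0 1))

  -- The case of a single entry `d`, started at `r`.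
  E₁ : (d : ℕ) .{{_ : NonZero d}} → ℚᵘ → ℕ
  E₁ d r = ∑ (λ a → weight r (pos a / d)) (upTo d)

  E-suc-prod : ∀ s .{{_ : ∀ {i} → NonZero (s i)}} N {d} .{{_ : NonZero d}} →
    s 0 ≡ d → prod s (suc N) ≡ d → ∀ r → E r s (suc N) ≡ E₁ d r
  E-suc-prod s N {d} s₀≡d prod≡d r = trans (E-suc-≡ r s N s₀≡d) (∑-cong
    (λ a → trans (cong (weight r (pos a / d) *_) (E-prod≡1 (s ∘ suc) N rest≡1 (0≤a/d a d))) (*-identityʳ _))
    (upTo d))
    where
    rest≡1 : prod (s ∘ suc) N ≡ 1
    rest≡1 = prod-tail s N 1 s₀≡d (trans prod≡d (sym (*-identityʳ d)))

  -- The second alternative arises when a 1 precedes the entry p.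
  E-prod-prime : ∀ {p} (pp : Prime p) .{{_ : NonZero p}} s .{{_ : ∀ {i} → NonZero (s i)}} N →
    prod s N ≡ p →
    (∀ {r} → 0ℚᵘ ≤ᵘ r → E r s N ≡ E₁ p r) ⊎ (∀ {r} → 0ℚᵘ ≤ᵘ r → E r s N ≡ E₁ p 0ℚᵘ)
  E-prod-prime pp s zero refl = contradiction pp (λ ())
  E-prod-prime {p} pp s (suc N) prod≡p
    with prime⇒irreducible pp (subst (s 0 ∣_) prod≡p (m∣m*n _))
  ... | inj₂ s₀≡p = inj₁ λ {r} _ → E-suc-prod s N s₀≡p prod≡p r
  ... | inj₁ s₀≡1 = inj₂ λ 0≤r → trans (E-suc-1 0≤r s N s₀≡1) E₀≡
    where
    rest≡p : prod (s ∘ suc) N ≡ p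
    rest≡p = prod-tail s N p s₀≡1 (trans prod≡p (sym (*-identityˡ p)))

    E₀≡ : E 0ℚᵘ (s ∘ suc) N ≡ E₁ p 0ℚᵘ
    -- The two alternatives agree at `0ℚᵘ`, so further ones before `p` change nothing.
    E₀≡ with E-prod-prime pp (s ∘ suc) N rest≡p
    ... | inj₁ E≡ = E≡ (0≤a/d 0 1)
    ... | inj₂ E≡ = E≡ (0≤a/d 0 1)

-- At 1 an ascent weighs as much as a non-ascent, so the sum merely counts inversion sequences.
E-at-1 : ∀ r s .{{_ : ∀ {i} → NonZero (s i)}} N → E 1 r s N ≡ prod s N
E-at-1 r s zero    = refl
E-at-1 r s (suc N) = begin
  E 1 r s (suc N)                                                   ≡⟨ E-suc 1 r s N ⟩
  ∑ (λ a → weight 1 r (pos a / s 0) * E 1 (pos a / s 0) (s ∘ suc) N) is ≡⟨ ∑-cong summand is ⟩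
  ∑ (const (prod (s ∘ suc) N)) is                                   ≡⟨ ∑-const _ is ⟩
  length is * prod (s ∘ suc) N                                      ≡⟨ cong (_* prod (s ∘ suc) N) (length-upTo (s 0)) ⟩
  s 0 * prod (s ∘ suc) N                                            ∎
  where
  open ≡-Reasoning
  is = upTo (s 0)
  weight≡1 : ∀ q → weight 1 r q ≡ 1
  weight≡1 q = if-eta (does (r ℚᵘ.<? q))
  summand : ∀ a → weight 1 r (pos a / s 0) * E 1 (pos a / s 0) (s ∘ suc) N ≡ prod (s ∘ suc) N
  summand a = trans (cong₂ _*_ (weight≡1 (pos a / s 0)) (E-at-1 (pos a / s 0) (s ∘ suc) N)) (*-identityˡ _)

∣10⇒ : ∀ {d} → d ∣ 10 → d ≡ 1 ⊎ d ≡ 2 ⊎ d ≡ 5 ⊎ d ≡ 10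
∣10⇒ d∣10 = from-yes
  -- A divisor of 10 is at most 10, so checking all `d` below 11 suffices.
  (allUpTo? (λ d → d ∣? 10 →-dec (d ≟ 1 ⊎-dec (d ≟ 2 ⊎-dec (d ≟ 5 ⊎-dec d ≟ 10)))) 11)
  (s≤s (∣⇒≤ d∣10)) d∣10

-- The alternatives are `p` reached with the ratio of the first entry intact, or after a reset by an
-- intervening 1. Once `x`, `d` and `p` are numerals, both sums are closed and evaluate.
E-suc-prime : ∀ x {p} (pp : Prime p) .{{_ : NonZero p}} s .{{_ : ∀ {i} → NonZero (s i)}} N
  d .{{_ : NonZero d}} → s 0 ≡ d → prod (s ∘ suc) N ≡ p →
  E x 0ℚᵘ s (suc N) ≡ ∑ (λ a → weight x 0ℚᵘ (pos a / d) * E₁ x p (pos a / d)) (upTo d) ⊎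
  E x 0ℚᵘ s (suc N) ≡ ∑ (λ a → weight x 0ℚᵘ (pos a / d) * E₁ x p 0ℚᵘ) (upTo d)
E-suc-prime x pp s N d s₀≡d rest≡p with E-prod-prime x pp (s ∘ suc) N rest≡p
... | inj₁ E≡ = inj₁ (trans (E-suc-≡ x 0ℚᵘ s N s₀≡d) (∑-cong (λ a → cong (weight x 0ℚᵘ (pos a / d) *_) (E≡ (0≤a/d a d))) (upTo d)))
... | inj₂ E≡ = inj₂ (trans (E-suc-≡ x 0ℚᵘ s N s₀≡d) (∑-cong (λ a → cong (weight x 0ℚᵘ (pos a / d) *_) (E≡ (0≤a/d a d))) (upTo d)))

-- Leading ones are stripped by recursion on `N`, as they leave the start at `0ℚᵘ`. The first entry
-- other than 1 is then 2, 5 or 10. The empty product is not 10, so `N` is a successor.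
E-prod≡10 : ∀ s .{{_ : ∀ {i} → NonZero (s i)}} N → prod s N ≡ 10 →
  E 2 0ℚᵘ s N ∈ 19 ∷ 23 ∷ 27 ∷ []
E-prod≡10 s (suc N) prod≡10 with ∣10⇒ (subst (s 0 ∣_) prod≡10 (m∣m*n _))
... | inj₁ s₀≡1 = subst (_∈ _) (sym (E-suc-1 2 (0≤a/d 0 1) s N s₀≡1))
  (E-prod≡10 (s ∘ suc) N (prod-tail s N 10 s₀≡1 prod≡10))
... | inj₂ (inj₁ s₀≡2)
  with E-suc-prime 2 (from-yes (prime? 5)) s N 2 s₀≡2 (prod-tail s N 5 s₀≡2 prod≡10)
-- By computation: 1 + 7x + 2x² at 2 without a reset, and (1 + x)(1 + 4x) at 2 with one.
...   | inj₁ E≡23 = there (here E≡23)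
...   | inj₂ E≡27 = there (there (here E≡27))
E-prod≡10 s (suc N) prod≡10 | inj₂ (inj₂ (inj₁ s₀≡5))
  with E-suc-prime 2 (from-yes (prime? 2)) s N 5 s₀≡5 (prod-tail s N 2 s₀≡5 prod≡10)
...   | inj₁ E≡23 = there (here E≡23)
...   | inj₂ E≡27 = there (there (here E≡27))
E-prod≡10 s (suc N) prod≡10 | inj₂ (inj₂ (inj₂ s₀≡10)) =
  here (E-suc-prod 2 s N s₀≡10 prod≡10 0ℚᵘ)

eval-sEulerian : ∀ x s .{{_ : ∀ {i} → NonZero (s i)}} N → eval x (sEulerian s N) ≡ E x 0ℚᵘ s N
eval-sEulerian x s N = eval-∑x^ x (asc s) (inversionSequences s N)

proposition25 : Σ[ n ∈ ℕ ] Σ[ m ∈ Vec ℕ n ]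
    n ≥ 1 × (∀ k → NonZero (lookup m k)) ×
    (∀ (N : ℕ) → N ≥ 1 →
    ∀ (s : ℕ → ℕ) .{{_ : ∀ {i} → NonZero (s i)}} →
    ¬ (multisetEulerian m ≈ sEulerian s N))
proposition25 = 2 , m , s≤s z≤n , (λ { zero → _ ; (suc zero) → _ }) , λ N _ s A≈E →
  let E≡A : ∀ x → E x 0ℚᵘ s N ≡ eval x (multisetEulerian m)
      E≡A x = trans (sym (eval-sEulerian x s N)) (sym (eval-≈ x (multisetEulerian m) (sEulerian s N) A≈E))
      -- The value of the multiset Eulerian polynomial at 1 computes to 10, the number of words with
      -- three letters of one kind and two of the other.
      prod≡10 = trans (sym (E-at-1 0ℚᵘ s N)) (E≡A 1)
  -- At 2 it computes to 25, which is none of the three possible values.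
  in contradiction (subst (_∈ _) (E≡A 2) (E-prod≡10 s N prod≡10))
       λ { (here ()) ; (there (here ())) ; (there (there (here ()))) }
  where
  m : Vec ℕ 2
  m = 3 ∷ 2 ∷ []
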